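{- Let $a,b,c$ be positive integers that are not all equal, and let $n=a+b+c$. Let $A=\{1,\dots,a\}$, $B=\{a+1,\dots,a+b\}$ and $C=\{a+b+1,\dots,n\}$. Define the $n\times n$ array $M=(M_{i,j})_{i,j\in[n]}$ of subsets of $[n]$ by \[ M_{i,j}=\begin{cases} A&\text{if } i\in A \text{ and } j\in A,\\ B&\text{if } i\in B \text{ and } j\in B,\\ C&\text{if } i\in C \text{ and } j\in C,\\ \emptyset&\text{otherwise}. \end{cases} \] Let $k\ge 1$ and let $N=(N_{i,j})_{i,j\in[n]}$ be any $(n^2,k)$-array. Then there exist $i,j\in[n]$ with $M_{i,j}\cap N_{i,j}\neq\emptyset$.
   Context: $[n]=\{1,2,\dots,n\}$. For positive integers $n,d,k$, an $(n^d,k)$-array is a $d$-dimensional array of dimensions $n\times n\times\cdots\times n$ such that each entry is a subset of $[n]$ of cardinality exactly $k$, and every number in $[n]$ occurs in exactly $k$ of the entries along any axis-parallel line of the array (an axis-parallel line is the set of $n$ cells obtained by fixing all coordinates but one). In particular an $(n^2,k)$-array is an $n\times n$ array of $k$-subsets of $[n]$ in which each symbol of $[n]$ lies in exactly $k$ entries of each row and exactly $k$ entries of each column. -}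

module Defs where

open import Data.Bool.Base using (if_then_else_)
open import Data.Fin.Base using (Fin)
open import Data.Fin.Subset using (Subset; ⊤; ⊥; ∣_∣)
open import Data.Fin.Subset.Properties using (_∈?_)
open import Data.Nat.Base using (ℕ; _+_)
open import Data.Vec.Base using (Vec; _++_; _[_]≔_; allFin; count)
open import Relation.Binary.PropositionalEquality using (_≡_)
open import Relation.Nullary.Decidable using (does; _×-dec_)

-- [n] = {1,…,n} is represented by Fin n, with x ∈ [n] corresponding to x - 1.

Array : (d n : ℕ) → Set
Array d n = Vec (Fin n) d → Subset n

-- The axis-parallel line through the cell x in direction l consists of the
-- cells x [ l ]≔ t for t : Fin n; the l-th coordinate of x itself is irrelevant.
record IsArray (d n k : ℕ) (N : Array d n) : Set where
  field
    entry-size : ∀ x → ∣ N x ∣ ≡ k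
    line-count : ∀ (l : Fin d) (x : Vec (Fin n) d) (s : Fin n) →
                 count (λ t → s ∈? N (x [ l ]≔ t)) (allFin n) ≡ k

module _ (a b c : ℕ) where

  A B C : Subset (a + b + c)
  A = (⊤ {a} ++ ⊥ {b}) ++ ⊥ {c}
  B = (⊥ {a} ++ ⊤ {b}) ++ ⊥ {c}
  C = (⊥ {a} ++ ⊥ {b}) ++ ⊤ {c}

  M : (i j : Fin (a + b + c)) → Subset (a + b + c)
  M i j =
    if does ((i ∈? A) ×-dec (j ∈? A)) then A else
    if does ((i ∈? B) ×-dec (j ∈? B)) then B else
    if does ((i ∈? C) ×-dec (j ∈? C)) then C else
    ⊥

{-# OPTIONS --safe #-}

-- Read N as a 0/1 tensor T(i,j,s) = [s ∈ N i j] all of whose line sums are k, and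
-- call two indices equivalent if they lie in the same of the parts A, B, C.  If M
-- and N were disjoint in every cell, no triple (i,j,s) in the support of T would
-- lie inside a single part, so each would contain at most one equivalent pair
-- among ij, is, js.  Summing over T gives 3k(a² + b² + c²) ≤ k(a + b + c)², that
-- is, (a - b)² + (b - c)² + (a - c)² ≤ 0.

module Submission where

open import Data.Bool.Base using (Bool; true; false; if_then_else_)
open import Data.Fin.Base using (Fin; zero; suc; splitAt; _↑ˡ_; _↑ʳ_)
open import Data.Fin.Patterns using (0F; 1F; 2F)
open import Data.Fin.Properties using (_≟_; all?; any?; splitAt⁻¹-↑ˡ; splitAt⁻¹-↑ʳ)
open import Data.Fin.Subset using (Subset; _∈_; ∣_∣; _∩_; Nonempty)
open import Data.Fin.Subset.Properties using (_∈?_; nonempty?; x∈p∩q⁺; ∣⊤∣≡n; ∣⊥∣≡0)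
open import Data.Nat.Base using (ℕ; zero; suc; _+_; _*_; _≤_; z≤n; ∣_-_∣; >-nonZero)
open import Data.Nat.Properties
  using (+-*-semiring; ≤-refl; +-mono-≤; +-identityʳ; *-identityʳ; *-zeroʳ; *-monoʳ-≤; *-cancelˡ-≤;
         +-cancelˡ-≤; n≤0⇒n≡0; m+n≡0⇒m≡0; m+n≡0⇒n≡0; m*n≡0⇒m≡0∨n≡0; ∣m-n∣≡0⇒m≡n; module ≤-Reasoning)
  renaming (_≟_ to _≟ℕ_)
open import Data.Nat.Tactic.RingSolver using (solve-∀)
open import Data.Product.Base using (_×_; ∃; ∃₂; _,_; proj₁; proj₂)
open import Data.Sum.Base using (inj₁; inj₂; reduce)
open import Data.Vec.Base using (_∷_; []; _++_; count; lookup; replicate; tabulate)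
open import Data.Vec.Properties using (lookup-++ˡ; lookup-++ʳ; lookup-replicate)
open import Function.Base using (_∘_)
open import Relation.Binary.PropositionalEquality
  using (_≡_; refl; sym; trans; cong; cong₂; module ≡-Reasoning)
open import Relation.Nullary.Decidable using (Dec; yes; no; does; dec-true; from-yes)
open import Relation.Nullary.Negation.Core using (¬_; contradiction)
open import Relation.Unary using (Decidable)
open import Algebra.Properties.Semiring.Sum +-*-semiring
  using (sum; sum-syntax; ∑-comm; ∑-distrib-+; *-distribˡ-sum; *-distribʳ-sum)
  renaming (sum-cong-≗ to ∑-cong)
open import Defs

-- Finite sums of natural numbers.

∑-mono : ∀ {n} {f g : Fin n → ℕ} → (∀ i → f i ≤ g i) → sum f ≤ sum g
∑-mono {zero}  f≤g = z≤n
∑-mono {suc n} f≤g = +-mono-≤ (f≤g zero) (∑-mono (f≤g ∘ suc))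

∑-const : ∀ n x → ∑[ i < n ] x ≡ n * x
∑-const zero    x = refl
∑-const (suc n) x = cong (x +_) (∑-const n x)

∑-distribˡ : ∀ {n} x (f : Fin n → ℕ) → ∑[ i < n ] (x * f i) ≡ x * sum f
∑-distribˡ x f = sym (*-distribˡ-sum x f)

∑-distribʳ : ∀ {n} x (f : Fin n → ℕ) → ∑[ i < n ] (f i * x) ≡ sum f * x
∑-distribʳ x f = sym (*-distribʳ-sum x f)

∑∑-distribˡ : ∀ {m n} x (f : Fin m → Fin n → ℕ) →
              ∑[ i < m ] ∑[ j < n ] (x * f i j) ≡ x * ∑[ i < m ] ∑[ j < n ] f i j
∑∑-distribˡ x f =
  trans (∑-cong λ i → ∑-distribˡ x (f i)) (∑-distribˡ x λ i → sum (f i))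

∑-product : ∀ {m n} (f : Fin m → ℕ) (g : Fin n → ℕ) →
            ∑[ i < m ] ∑[ j < n ] (f i * g j) ≡ sum f * sum g
∑-product f g = trans (∑-cong λ i → ∑-distribˡ (f i) g) (∑-distribʳ (sum g) f)

∑³ : ∀ n → (Fin n → Fin n → Fin n → ℕ) → ℕ
∑³ n f = ∑[ x < n ] ∑[ y < n ] ∑[ z < n ] f x y z

∑³-cong : ∀ {n} {f g : Fin n → Fin n → Fin n → ℕ} →
          (∀ x y z → f x y z ≡ g x y z) → ∑³ n f ≡ ∑³ n g
∑³-cong f≡g = ∑-cong λ x → ∑-cong λ y → ∑-cong λ z → f≡g x y z

∑³-distrib-+ : ∀ {n} (f g : Fin n → Fin n → Fin n → ℕ) →
               ∑³ n (λ x y z → f x y z + g x y z) ≡ ∑³ n f + ∑³ n g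
∑³-distrib-+ f g = trans
  (∑-cong λ x → trans
    (∑-cong λ y → ∑-distrib-+ (f x y) (g x y))
    (∑-distrib-+ (λ y → sum (f x y)) (λ y → sum (g x y))))
  (∑-distrib-+ (λ x → ∑[ y < _ ] sum (f x y)) (λ x → ∑[ y < _ ] sum (g x y)))

-- The weight does not depend on `z`, so it factors out of each innermost sum. Permuting the
-- arguments of `f` covers the lines of a tensor in all three directions.
∑³-weighted : ∀ {n k} (f : Fin n → Fin n → Fin n → ℕ) (w : Fin n → Fin n → ℕ) →
              (∀ x y → sum (f x y) ≡ k) →
              ∑³ n (λ x y z → f x y z * w x y) ≡ k * ∑[ x < n ] ∑[ y < n ] w x y
∑³-weighted {n} {k} f w ∑f≡k = trans
  (∑-cong λ x → ∑-cong λ y →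
    trans (∑-distribʳ (w x y) (f x y)) (cong (_* w x y) (∑f≡k x y)))
  (∑∑-distribˡ k w)

-- Indicators and cardinalities.

⟦_⟧ : Bool → ℕ
⟦ b ⟧ = if b then 1 else 0

count-tabulate : ∀ {n} {X : Set} {P : X → Set} (P? : Decidable P) (f : Fin n → X) →
                 count P? (tabulate f) ≡ ∑[ t < n ] ⟦ does (P? (f t)) ⟧
count-tabulate {zero}  P? f = refl
count-tabulate {suc n} P? f with does (P? (f zero))
... | true  = cong suc (count-tabulate P? (f ∘ suc))
... | false = count-tabulate P? (f ∘ suc)

∣∣-as-∑ : ∀ {n} (p : Subset n) → ∣ p ∣ ≡ ∑[ x < n ] ⟦ does (x ∈? p) ⟧
∣∣-as-∑ []          = refl
∣∣-as-∑ (true  ∷ p) = cong suc (∣∣-as-∑ p)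
∣∣-as-∑ (false ∷ p) = ∣∣-as-∑ p

∣++∣ : ∀ {m n} (p : Subset m) (q : Subset n) → ∣ p ++ q ∣ ≡ ∣ p ∣ + ∣ q ∣
∣++∣ []          q = refl
∣++∣ (true  ∷ p) q = cong suc (∣++∣ p q)
∣++∣ (false ∷ p) q = ∣++∣ p q

does-∈? : ∀ {n} (x : Fin n) (p : Subset n) → does (x ∈? p) ≡ lookup p x
does-∈? zero    (true  ∷ p) = refl
does-∈? zero    (false ∷ p) = refl
does-∈? (suc x) (_ ∷ p)     = does-∈? x p

does⇒ : ∀ {P : Set} (P? : Dec P) → does P? ≡ true → P
does⇒ (yes p) _ = p

same : ∀ {n} → Fin n → Fin n → ℕ
same x y = ⟦ does (x ≟ y) ⟧

-- Only `d = x` can contribute. This separates the variables of the relation, so that a double sum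
-- over it splits into products.
same-as-∑ : ∀ (x y : Fin 3) → same x y ≡ ∑[ d < 3 ] (same d x * same d y)
same-as-∑ = from-yes (all? λ x → all? λ y → same x y ≟ℕ ∑[ d < 3 ] (same d x * same d y))

-- By transitivity, two equal pairs would force all three elements to coincide.
same-pairs : ∀ {n} (x y z : Fin n) → ¬ (x ≡ y × y ≡ z) →
             same x y + same x z + same y z ≤ 1
same-pairs x y z ¬≡ with x ≟ y | x ≟ z | y ≟ z
... | yes refl | yes refl | _        = contradiction (refl , refl) ¬≡
... | yes refl | no x≢z   | yes refl = contradiction refl x≢z
... | yes refl | no _     | no _     = ≤-refl
... | no x≢y   | yes refl | yes refl = contradiction refl x≢y
... | no _     | yes refl | no _     = ≤-refl
... | no _     | no _     | yes refl = ≤-refl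
... | no _     | no _     | no _     = z≤n

-- The partition into three parts and its diagonal blocks.

module _ (a b c : ℕ) where

  -- part 0F, part 1F and part 2F are definitionally A, B and C.
  part : Fin 3 → Subset (a + b + c)
  part d = (replicate a (does (d ≟ 0F)) ++ replicate b (does (d ≟ 1F)))
             ++ replicate c (does (d ≟ 2F))

  size : Fin 3 → ℕ
  size 0F = a
  size 1F = b
  size 2F = c

  ∣part∣ : ∀ d → ∣ part d ∣ ≡ size d
  ∣part∣ d = trans (∣++∣ (replicate a (does (d ≟ 0F)) ++ replicate b (does (d ≟ 1F))) _)
    (trans (cong (_+ _) (∣++∣ (replicate a (does (d ≟ 0F))) _)) (sizes d))
    where
    sizes : ∀ d → ∣ replicate a (does (d ≟ 0F)) ∣ + ∣ replicate b (does (d ≟ 1F)) ∣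
                    + ∣ replicate c (does (d ≟ 2F)) ∣ ≡ size d
    sizes 0F rewrite ∣⊤∣≡n a | ∣⊥∣≡0 b | ∣⊥∣≡0 c = trans (+-identityʳ (a + 0)) (+-identityʳ a)
    sizes 1F rewrite ∣⊥∣≡0 a | ∣⊤∣≡n b | ∣⊥∣≡0 c = +-identityʳ b
    sizes 2F rewrite ∣⊥∣≡0 a | ∣⊥∣≡0 b | ∣⊤∣≡n c = refl

  -- A single `e` serving every `d` says at once that the parts cover everything and are disjoint.
  lookup-part : ∀ i → ∃ λ e → ∀ d → lookup (part d) i ≡ does (d ≟ e)
  lookup-part i with splitAt (a + b) i in eq
  ... | inj₂ x rewrite sym (splitAt⁻¹-↑ʳ {a + b} eq) = 2F , λ d → trans
          (lookup-++ʳ (replicate a _ ++ replicate b _) _ x) (lookup-replicate x _)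
  ... | inj₁ x with splitAt a x in eq′
  ...   | inj₁ y rewrite sym (splitAt⁻¹-↑ˡ {n = c} eq) | sym (splitAt⁻¹-↑ˡ {n = b} eq′) =
          0F , λ d → trans (lookup-++ˡ (replicate a _ ++ replicate b _) _ (y ↑ˡ b))
            (trans (lookup-++ˡ (replicate a _) _ y) (lookup-replicate y _))
  ...   | inj₂ y rewrite sym (splitAt⁻¹-↑ˡ {n = c} eq) | sym (splitAt⁻¹-↑ʳ {a} eq′) =
          1F , λ d → trans (lookup-++ˡ (replicate a _ ++ replicate b _) _ (a ↑ʳ y))
            (trans (lookup-++ʳ (replicate a _) _ y) (lookup-replicate y _))

  class : Fin (a + b + c) → Fin 3
  class i = proj₁ (lookup-part i)

  does-∈-part : ∀ i d → does (i ∈? part d) ≡ does (d ≟ class i)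
  does-∈-part i d = trans (does-∈? i (part d)) (proj₂ (lookup-part i) d)

  ∈-part-class : ∀ i → i ∈ part (class i)
  ∈-part-class i = does⇒ (i ∈? part (class i))
    (trans (does-∈-part i (class i)) (dec-true (class i ≟ class i) refl))

  -- The rewrites turn every membership test in `M` into a comparison of `class i` with a literal,
  -- so each case then computes.
  M-diagonal : ∀ i j → class i ≡ class j → M a b c i j ≡ part (class i)
  M-diagonal i j eq
    rewrite does-∈-part i 0F | does-∈-part i 1F | does-∈-part i 2F
          | does-∈-part j 0F | does-∈-part j 1F | does-∈-part j 2F
          | sym eq
    with class i
  ... | 0F = refl
  ... | 1F = refl
  ... | 2F = refl

  -- The equivalent pairs form three square blocks; moving the sum over `d` outermost counts them
  -- block by block.
  ∑-same-class : ∑[ i < a + b + c ] ∑[ j < a + b + c ] same (class i) (class j)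
                   ≡ a * a + b * b + c * c
  ∑-same-class = begin
    ∑[ i < n ] ∑[ j < n ] same (class i) (class j)
      ≡⟨ (∑-cong λ i → ∑-cong λ j → same-as-∑ (class i) (class j)) ⟩
    ∑[ i < n ] ∑[ j < n ] ∑[ d < 3 ] (same d (class i) * same d (class j))
      ≡⟨ (∑-cong λ i → ∑-comm λ j d → same d (class i) * same d (class j)) ⟩
    ∑[ i < n ] ∑[ d < 3 ] ∑[ j < n ] (same d (class i) * same d (class j))
      ≡⟨ (∑-comm λ i d → ∑[ j < n ] (same d (class i) * same d (class j))) ⟩
    ∑[ d < 3 ] ∑[ i < n ] ∑[ j < n ] (same d (class i) * same d (class j))
      ≡⟨ (∑-cong λ d → ∑-product (λ i → same d (class i)) (λ j → same d (class j))) ⟩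
    ∑[ d < 3 ] (∑[ i < n ] same d (class i) * ∑[ j < n ] same d (class j))
      ≡⟨ (∑-cong λ d → cong₂ _*_ (∑-same d) (∑-same d)) ⟩
    ∑[ d < 3 ] (size d * size d)
      ≡⟨ regroup (a * a) (b * b) (c * c) ⟩
    a * a + b * b + c * c ∎
    where
    open ≡-Reasoning
    n = a + b + c
    regroup : ∀ x y z → x + (y + (z + 0)) ≡ x + y + z
    regroup = solve-∀
    ∑-same : ∀ d → ∑[ i < n ] same d (class i) ≡ size d
    ∑-same d = trans (∑-cong λ i → cong ⟦_⟧ (sym (does-∈-part i d)))
      (trans (sym (∣∣-as-∑ (part d))) (∣part∣ d))

-- Squares of differences in the natural numbers.

sum-of-two-squares : ∀ x y → x * x + y * y ≡ ∣ x - y ∣ * ∣ x - y ∣ + 2 * (x * y)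
sum-of-two-squares zero    y       = sym (+-identityʳ (y * y))
sum-of-two-squares (suc x) zero    = cong (suc x * suc x +_) (sym (cong (2 *_) (*-zeroʳ x)))
-- Raising both arguments by one keeps their distance, so the induction hypothesis has the same `D`.
sum-of-two-squares (suc x) (suc y) = begin
  suc x * suc x + suc y * suc y      ≡⟨ left x y ⟩
  x * x + y * y + 2 * (1 + x + y)    ≡⟨ cong (_+ 2 * (1 + x + y)) (sum-of-two-squares x y) ⟩
  D * D + 2 * (x * y) + 2 * (1 + x + y) ≡⟨ right (D * D) x y ⟩
  D * D + 2 * (suc x * suc y)        ∎
  where
  open ≡-Reasoning
  D = ∣ x - y ∣
  left : ∀ x y → suc x * suc x + suc y * suc y ≡ x * x + y * y + 2 * (1 + x + y)
  left = solve-∀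
  right : ∀ d x y → d + 2 * (x * y) + 2 * (1 + x + y) ≡ d + 2 * (suc x * suc y)
  right = solve-∀

sum-of-squares-≤⇒≡ : ∀ a b c → 3 * (a * a + b * b + c * c) ≤ (a + b + c) * (a + b + c) →
                     a ≡ b × b ≡ c
sum-of-squares-≤⇒≡ a b c le = equal a b (m+n≡0⇒m≡0 D₁ (m+n≡0⇒m≡0 (D₁ + D₂) D≡0)) ,
                              equal b c (m+n≡0⇒n≡0 D₁ (m+n≡0⇒m≡0 (D₁ + D₂) D≡0))
  where
  D₁ = ∣ a - b ∣ * ∣ a - b ∣
  D₂ = ∣ b - c ∣ * ∣ b - c ∣
  D₃ = ∣ a - c ∣ * ∣ a - c ∣
  S = (a + b + c) * (a + b + c)
  -- The three pairs use two copies of each square; the third copy joins the cross terms to complete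
  -- `(a + b + c) * (a + b + c)`.
  pairs : ∀ a b c → 3 * (a * a + b * b + c * c) ≡
          (a * a + b * b) + (b * b + c * c) + (a * a + c * c) + (a * a + b * b + c * c)
  pairs = solve-∀
  collect : ∀ a b c d e f →
    (d + 2 * (a * b)) + (e + 2 * (b * c)) + (f + 2 * (a * c)) + (a * a + b * b + c * c)
      ≡ (a + b + c) * (a + b + c) + (d + e + f)
  collect = solve-∀
  excess : 3 * (a * a + b * b + c * c) ≡ S + (D₁ + D₂ + D₃)
  excess = trans (pairs a b c) (trans
    (cong (_+ (a * a + b * b + c * c)) (cong₂ _+_
      (cong₂ _+_ (sum-of-two-squares a b) (sum-of-two-squares b c)) (sum-of-two-squares a c)))
    (collect a b c D₁ D₂ D₃))
  D≡0 : D₁ + D₂ + D₃ ≡ 0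
  D≡0 = n≤0⇒n≡0 (+-cancelˡ-≤ S _ _ (begin
    S + (D₁ + D₂ + D₃)            ≡⟨ excess ⟨
    3 * (a * a + b * b + c * c)   ≤⟨ le ⟩
    S                             ≡⟨ +-identityʳ S ⟨
    S + 0                         ∎))
    where open ≤-Reasoning
  equal : ∀ x y → ∣ x - y ∣ * ∣ x - y ∣ ≡ 0 → x ≡ y
  -- Both factors are `∣ x - y ∣`, so the two alternatives are the same equation and `reduce` merges
  -- them.
  equal x y D≡0 = ∣m-n∣≡0⇒m≡n (reduce (m*n≡0⇒m≡0∨n≡0 ∣ x - y ∣ D≡0))

-- Weighted sums over the tensor of an array.

module _ {n k : ℕ} {N : Array 2 n} (isArray : IsArray 2 n k N) where
  open IsArray isArray

  -- The tensor `T`. In this form the cell size and the two line conditions become one condition in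
  -- three directions, symmetric in row, column and symbol.
  entry : Fin n → Fin n → Fin n → ℕ
  entry i j s = ⟦ does (s ∈? N (i ∷ j ∷ [])) ⟧

  ∑-symbols : ∀ i j → ∑[ s < n ] entry i j s ≡ k
  ∑-symbols i j = trans (sym (∣∣-as-∑ (N (i ∷ j ∷ [])))) (entry-size (i ∷ j ∷ []))

  ∑-columns : ∀ i s → ∑[ j < n ] entry i j s ≡ k
  ∑-columns i s = trans (sym (count-tabulate (λ j → s ∈? N (i ∷ j ∷ [])) (λ j → j)))
    -- The second coordinate is overwritten along the line; `i` merely fills the place.
    (line-count 1F (i ∷ i ∷ []) s)

  ∑-rows : ∀ j s → ∑[ i < n ] entry i j s ≡ k
  ∑-rows j s = trans (sym (count-tabulate (λ i → s ∈? N (i ∷ j ∷ [])) (λ i → i)))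
    (line-count 0F (j ∷ j ∷ []) s)

  -- Each of the three weights ignores one index, and summing the tensor over that index gives `k`.
  ∑-pair-weights : (w : Fin n → Fin n → ℕ) →
    ∑³ n (λ i j s → entry i j s * (w i j + w i s + w j s))
      ≡ k * (3 * ∑[ x < n ] ∑[ y < n ] w x y)
  ∑-pair-weights w = begin
    ∑³ n (λ i j s → entry i j s * (w i j + w i s + w j s))
      ≡⟨ ∑³-cong (λ i j s → distrib (entry i j s) (w i j) (w i s) (w j s)) ⟩
    ∑³ n (λ i j s → entry i j s * w i j + entry i j s * w i s + entry i j s * w j s)
      ≡⟨ ∑³-distrib-+ (λ i j s → entry i j s * w i j + entry i j s * w i s) _ ⟩
    ∑³ n (λ i j s → entry i j s * w i j + entry i j s * w i s) + ∑³ n (λ i j s → entry i j s * w j s)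
      ≡⟨ cong (_+ ∑³ n (λ i j s → entry i j s * w j s)) (∑³-distrib-+ (λ i j s → entry i j s * w i j) _) ⟩
    ∑³ n (λ i j s → entry i j s * w i j) + ∑³ n (λ i j s → entry i j s * w i s)
      + ∑³ n (λ i j s → entry i j s * w j s)
      ≡⟨ cong₂ _+_ (cong₂ _+_ (∑³-weighted entry w ∑-symbols) is-pairs) js-pairs ⟩
    k * W + k * W + k * W
      ≡⟨ triple k W ⟩
    k * (3 * W) ∎
    where
    open ≡-Reasoning
    W = ∑[ x < n ] ∑[ y < n ] w x y
    distrib : ∀ t x y z → t * (x + y + z) ≡ t * x + t * y + t * z
    distrib = solve-∀
    triple : ∀ k W → k * W + k * W + k * W ≡ k * (3 * W)
    triple = solve-∀
    is-pairs : ∑³ n (λ i j s → entry i j s * w i s) ≡ k * W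
    is-pairs = trans
      (∑-cong λ i → ∑-comm λ j s → entry i j s * w i s)
      (∑³-weighted (λ i s j → entry i j s) w ∑-columns)
    js-pairs : ∑³ n (λ i j s → entry i j s * w j s) ≡ k * W
    js-pairs = trans
      -- The ignored index is `i`, which has to pass both `j` and `s` to become innermost.
      (∑-comm λ i j → ∑[ s < n ] (entry i j s * w j s))
      (trans
        (∑-cong λ j → ∑-comm λ i s → entry i j s * w j s)
        (∑³-weighted (λ j s i → entry i j s) w ∑-rows))

  -- The factor 1 is a constant weight, matching the bound of one equivalent pair per triple.
  ∑-entries : ∑³ n (λ i j s → entry i j s * 1) ≡ k * (n * n)
  ∑-entries = trans (∑³-weighted entry (λ _ _ → 1) ∑-symbols)
    (cong (k *_) (trans (∑-const n (∑[ j < n ] 1))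
      (cong (n *_) (trans (∑-const n 1) (*-identityʳ n)))))

-- The contradiction from disjointness.

theorem1 : (a b c : ℕ) → 1 ≤ a → 1 ≤ b → 1 ≤ c → ¬ (a ≡ b × b ≡ c) →
    (k : ℕ) → 1 ≤ k →
    (N : Array 2 (a + b + c)) → IsArray 2 (a + b + c) k N →
    ∃₂ λ i j → Nonempty (M a b c i j ∩ N (i ∷ j ∷ []))
theorem1 a b c _ _ _ ¬equal k 1≤k N isArray
  -- Meeting in some cell is decidable by finite search, so arguing by contradiction is
  -- constructive.
  with any? (λ i → any? λ j → nonempty? (M a b c i j ∩ N (i ∷ j ∷ [])))
... | yes found   = found
... | no disjoint = contradiction (sum-of-squares-≤⇒≡ a b c squares) ¬equal
  where
  n = a + b + c
  κ = class a b c

  w : Fin n → Fin n → ℕ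
  w x y = same (κ x) (κ y)

  -- Otherwise `M a b c i j` is the whole part containing `s`, and the cell meets `N`.
  not-in-one-part : ∀ i j s → s ∈ N (i ∷ j ∷ []) → ¬ (κ i ≡ κ j × κ j ≡ κ s)
  not-in-one-part i j s s∈N (ij , js) = disjoint (i , j , s , x∈p∩q⁺ (s∈M , s∈N))
    where
    s∈M : s ∈ M a b c i j
    s∈M rewrite M-diagonal a b c i j ij | trans ij js = ∈-part-class a b c s

  -- Off the support both sides are 0; on it the entry is 1 and `same-pairs` applies.
  at-most-one-pair : ∀ i j s → entry isArray i j s * (w i j + w i s + w j s) ≤ entry isArray i j s * 1
  at-most-one-pair i j s with s ∈? N (i ∷ j ∷ [])
  ... | no _    = z≤n
  ... | yes s∈N = *-monoʳ-≤ 1 (same-pairs (κ i) (κ j) (κ s) (not-in-one-part i j s s∈N))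

  squares : 3 * (a * a + b * b + c * c) ≤ n * n
  -- Both sides carry a factor `k`, which cancels because `1 ≤ k`.
  squares = *-cancelˡ-≤ k {{>-nonZero 1≤k}} (begin
    k * (3 * (a * a + b * b + c * c))
      ≡⟨ cong (λ Q → k * (3 * Q)) (∑-same-class a b c) ⟨
    k * (3 * ∑[ x < n ] ∑[ y < n ] w x y)
      ≡⟨ ∑-pair-weights isArray w ⟨
    ∑³ n (λ i j s → entry isArray i j s * (w i j + w i s + w j s))
      ≤⟨ (∑-mono λ i → ∑-mono λ j → ∑-mono λ s → at-most-one-pair i j s) ⟩
    ∑³ n (λ i j s → entry isArray i j s * 1)
      ≡⟨ ∑-entries isArray ⟩
    k * (n * n) ∎)
    where open ≤-Reasoning
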